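{- The category model validates the rule $\mathsf{Hom}$-Intro: from $\Gamma\vdash A\,\mathsf{Ty}$ infer $\Gamma.a:A\vdash\mathsf{refl}_a:_d\mathsf{Hom}_A(\bar a,a)$.
   Context: For a strict functor $F:\Gamma\to\mathbf{Cat}$, $\Gamma\diamond F$ is the covariant Grothendieck construction (objects $(\gamma,x)$, $x\in F(\gamma)$; morphisms $(g:\gamma\to\gamma',\ \xi:F(g)x\to x')$), and $F^{\mathrm{op}}:=\mathrm{op}\circ F$. Category model: a context is a category $\Gamma$; a type $\Gamma\vdash A\,\mathsf{Ty}$ is a strict functor $A:\Gamma\to\mathbf{Cat}$; $\Gamma.a:A$ is $\Gamma\diamond A$; $A^{\mathrm{op}}$ is $\mathrm{op}\circ A$; $\mathsf{Hom}_A$ is the type in context $\Gamma.b:A.a:A^{\mathrm{op}}$ given by $(\gamma,b,a)\mapsto\hom_{A(\gamma)}(a,b)$ (a discrete category). A displayed type $\Gamma\vdash E\,\mathsf{Ty}_d$ is (up to equivalence) an arbitrary functor into $\Gamma$, substitution is pullback, and a term $\Gamma\vdash e:_dE$ is a section of that functor. Twisting: for a type $\Delta.b:B^{\mathrm{op}}\vdash C$, i.e. $C:\Delta\diamond B^{\mathrm{op}}\to\mathbf{Cat}$, the twisted displayed type $\Delta.b:B\vdash C[\bar b/b]\,\mathsf{Ty}_d$ is the functor $\pi_2:\Delta\diamond(B\ltimes C)\to\Delta\diamond B$, where $\Delta\diamond(B\ltimes C)$ has objects $(\delta,b,c)$ with $c\in C(\delta,b)$ and morphisms $(\delta,b,c)\to(\delta',b',c')$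 triples $(g:\delta\to\delta',\ \beta:B(g)b\to b',\ \theta:C(g,\mathrm{id}_{B(g)b})c\to C(\mathrm{id}_{\delta'},\beta)c')$, and $\pi_2$ forgets the last component. Twisting $\mathsf{Hom}_A$ in the variable $a$ (with $\Delta=\Gamma.b:A$, $B=A$ weakened) gives $\Gamma.b:A.a:A\vdash\mathsf{Hom}_A(\bar a,b)\,\mathsf{Ty}_d$; substituting $a$ for $b$, i.e. pulling back along the diagonal $\Gamma\diamond A\to\Gamma\diamond A\diamond A$, gives $\Gamma.a:A\vdash\mathsf{Hom}_A(\bar a,a)\,\mathsf{Ty}_d$. The corresponding requirement (desideratum) is that $\mathsf{refl}$ be the section whose value at $(\gamma,a)$ is the arrow $\mathrm{id}_a$ of $A(\gamma)$. -}

module Defs where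

open import Level using (Level; _⊔_; suc)
open import Data.Product using (Σ; Σ-syntax; _,_; proj₁; proj₂)
open import Relation.Binary.PropositionalEquality
  using (_≡_; refl; sym; trans; cong)

private
  variable
    ℓ o h o′ h′ o″ h″ : Level

-- Axiom K is in force, so objects and arrows form sets and `_≡_` is
-- strict equality.
record Category (o h : Level) : Set (suc (o ⊔ h)) where
  infixr 9 _∘_
  field
    Ob        : Set o
    Hom       : Ob → Ob → Set h
    id        : ∀ {x} → Hom x x
    _∘_       : ∀ {x y z} → Hom y z → Hom x y → Hom x z
    identityˡ : ∀ {x y} {f : Hom x y} → id ∘ f ≡ f
    identityʳ : ∀ {x y} {f : Hom x y} → f ∘ id ≡ f
    assoc     : ∀ {w x y z} {f : Hom y z} {g : Hom x y} {k : Hom w x} →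
                (f ∘ g) ∘ k ≡ f ∘ (g ∘ k)

open Category using (Ob; Hom)

id : (C : Category o h) {x : Ob C} → Hom C x x
id C = Category.id C

infix 10 _[_∘_]
_[_∘_] : (C : Category o h) {x y z : Ob C} → Hom C y z → Hom C x y → Hom C x z
C [ f ∘ g ] = Category._∘_ C f g

-- Equality of arrows whose endpoints are not assumed to agree: it says
-- that the endpoints are equal and, over that, so are the arrows.
infix 10 _[_≋_]
data _[_≋_] (C : Category o h) {x y : Ob C} (f : Hom C x y) :
            {x′ y′ : Ob C} → Hom C x′ y′ → Set (o ⊔ h) where
  refl : C [ f ≋ f ]

eqToHom : (C : Category o h) {x y : Ob C} → x ≡ y → Hom C x y
eqToHom C refl = id C

op : Category o h → Category o h
op C = record
  { Ob        = Ob C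
  ; Hom       = λ x y → Hom C y x
  ; id        = Category.id C
  ; _∘_       = λ f g → C [ g ∘ f ]
  ; identityˡ = Category.identityʳ C
  ; identityʳ = Category.identityˡ C
  ; assoc     = sym (Category.assoc C)
  }

Discrete : Set ℓ → Category ℓ ℓ
Discrete X = record
  { Ob        = X
  ; Hom       = _≡_
  ; id        = refl
  ; _∘_       = λ q p → trans p q
  ; identityˡ = λ { {f = refl} → refl }
  ; identityʳ = refl
  ; assoc     = λ { {k = refl} → refl }
  }

record Functor (C : Category o h) (D : Category o′ h′) :
               Set (o ⊔ h ⊔ o′ ⊔ h′) where
  field
    F₀           : Ob C → Ob D
    F₁           : ∀ {x y} → Hom C x y → Hom D (F₀ x) (F₀ y)
    identity     : ∀ {x} → F₁ (id C {x}) ≡ id D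
    homomorphism : ∀ {x y z} {f : Hom C y z} {g : Hom C x y} →
                   F₁ (C [ f ∘ g ]) ≡ D [ F₁ f ∘ F₁ g ]

open Functor using (F₀; F₁)

idF : {C : Category o h} → Functor C C
idF = record { F₀ = λ x → x ; F₁ = λ f → f ; identity = refl ; homomorphism = refl }

infixr 9 _∘F_
_∘F_ : {C : Category o h} {D : Category o′ h′} {E : Category o″ h″} →
       Functor D E → Functor C D → Functor C E
G ∘F F = record
  { F₀           = λ x → F₀ G (F₀ F x)
  ; F₁           = λ f → F₁ G (F₁ F f)
  ; identity     = trans (cong (F₁ G) (Functor.identity F)) (Functor.identity G)
  ; homomorphism = trans (cong (F₁ G) (Functor.homomorphism F)) (Functor.homomorphism G)
  }

-- Strict equality of functors, stated pointwise since function
-- extensionality is unavailable.  Equality on objects is included: it is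
-- the equality of endpoints at identity arrows.
infix 4 _≈_
_≈_ : {C : Category o h} {D : Category o′ h′} → Functor C D → Functor C D →
      Set (o ⊔ h ⊔ o′ ⊔ h′)
_≈_ {C = C} {D = D} F G = ∀ {x y} (f : Hom C x y) → D [ F₁ F f ≋ F₁ G f ]

opF : {C : Category o h} {D : Category o′ h′} → Functor C D → Functor (op C) (op D)
opF F = record
  { F₀           = F₀ F
  ; F₁           = F₁ F
  ; identity     = Functor.identity F
  ; homomorphism = Functor.homomorphism F
  }

mapDiscrete : {X : Set ℓ} {Y : Set h} → (X → Y) → Functor (Discrete X) (Discrete Y)
mapDiscrete f = record
  { F₀           = f
  ; F₁           = cong f
  ; identity     = refl
  ; homomorphism = λ { {f = refl} {g = refl} → refl }
  }

-- Types in context Γ are strict functors Γ → Cat.  They get their own record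
-- because functors are compared by `_≈_`, so that Cat is not a `Category`.
record Ty (Γ : Category o h) (o′ h′ : Level) : Set (o ⊔ h ⊔ suc (o′ ⊔ h′)) where
  field
    fib    : Ob Γ → Category o′ h′
    act    : ∀ {γ δ} → Hom Γ γ δ → Functor (fib γ) (fib δ)
    act-id : ∀ {γ} → act (id Γ {γ}) ≈ idF
    act-∘  : ∀ {γ δ ε} (g : Hom Γ δ ε) (f : Hom Γ γ δ) →
             act (Γ [ g ∘ f ]) ≈ act g ∘F act f

open Ty using (fib; act)

module _ {C : Category o h} where

  ≡⇒≋ : {x y : Ob C} {f g : Hom C x y} → f ≡ g → C [ f ≋ g ]
  ≡⇒≋ refl = refl

  ≋-trans : {x y x′ y′ x″ y″ : Ob C} {f : Hom C x y} {g : Hom C x′ y′} {k : Hom C x″ y″} →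
            C [ f ≋ g ] → C [ g ≋ k ] → C [ f ≋ k ]
  ≋-trans refl q = q

  ≋-sym : {x y x′ y′ : Ob C} {f : Hom C x y} {g : Hom C x′ y′} →
          C [ f ≋ g ] → C [ g ≋ f ]
  ≋-sym refl = refl

  ≋-source : {x y x′ y′ : Ob C} {f : Hom C x y} {g : Hom C x′ y′} →
             C [ f ≋ g ] → x ≡ x′
  ≋-source refl = refl

  ≋-op : {x y x′ y′ : Ob C} {f : Hom C x y} {g : Hom C x′ y′} →
         C [ f ≋ g ] → op C [ f ≋ g ]
  ≋-op refl = refl

module Fibred {Γ : Category o h} (A : Ty Γ o′ h′) where

  -- Equality of arrows lying in possibly different fibres of A.
  infix 4 _~_
  data _~_ {γ : Ob Γ} {x y : Ob (fib A γ)} (f : Hom (fib A γ) x y) :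
           {δ : Ob Γ} {x′ y′ : Ob (fib A δ)} → Hom (fib A δ) x′ y′ →
           Set (o ⊔ o′ ⊔ h′) where
    refl : f ~ f

  private
    variable
      γ δ ε : Ob Γ

  infixr 5 _◾_
  _◾_ : ∀ {x y x′ y′ x″ y″}
        {f : Hom (fib A γ) x y} {g : Hom (fib A δ) x′ y′} {k : Hom (fib A ε) x″ y″} →
        f ~ g → g ~ k → f ~ k
  refl ◾ q = q

  inv : ∀ {x y x′ y′} {f : Hom (fib A γ) x y} {g : Hom (fib A δ) x′ y′} →
        f ~ g → g ~ f
  inv refl = refl

  from≡ : ∀ {x y} {f g : Hom (fib A γ) x y} → f ≡ g → f ~ g
  from≡ refl = refl

  to≡ : ∀ {x y} {f g : Hom (fib A γ) x y} → f ~ g → f ≡ g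
  to≡ refl = refl

  from≋ : ∀ {x y x′ y′} {f : Hom (fib A γ) x y} {g : Hom (fib A γ) x′ y′} →
          fib A γ [ f ≋ g ] → f ~ g
  from≋ refl = refl

  to≋ : ∀ {x y x′ y′} {f : Hom (fib A γ) x y} {g : Hom (fib A γ) x′ y′} →
        f ~ g → fib A γ [ f ≋ g ]
  to≋ refl = refl

  infixr 6 _⟩∘⟨_
  _⟩∘⟨_ : ∀ {x y z x′ y′ z′}
          {f : Hom (fib A γ) y z} {f′ : Hom (fib A δ) y′ z′}
          {g : Hom (fib A γ) x y} {g′ : Hom (fib A δ) x′ y′} →
          f ~ f′ → g ~ g′ → fib A γ [ f ∘ g ] ~ fib A δ [ f′ ∘ g′ ]
  refl ⟩∘⟨ refl = refl

  reassoc : ∀ {w x y z} {f : Hom (fib A γ) y z} {g : Hom (fib A γ) x y}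
            {k : Hom (fib A γ) w x} →
            fib A γ [ fib A γ [ f ∘ g ] ∘ k ] ~ fib A γ [ f ∘ fib A γ [ g ∘ k ] ]
  reassoc {γ = γ} = from≡ (Category.assoc (fib A γ))

  castˡ : ∀ {x y z} {f : Hom (fib A γ) x y} (p : y ≡ z) →
          fib A γ [ eqToHom (fib A γ) p ∘ f ] ~ f
  castˡ {γ = γ} refl = from≡ (Category.identityˡ (fib A γ))

  castʳ : ∀ {x y z} {f : Hom (fib A γ) y z} (p : x ≡ y) →
          fib A γ [ f ∘ eqToHom (fib A γ) p ] ~ f
  castʳ {γ = γ} refl = from≡ (Category.identityʳ (fib A γ))

  opcastˡ : ∀ {x y z} {f : Hom (fib A γ) x y} (p : z ≡ y) →
            fib A γ [ eqToHom (op (fib A γ)) p ∘ f ] ~ f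
  opcastˡ {γ = γ} refl = from≡ (Category.identityˡ (fib A γ))

  opcastʳ : ∀ {x y z} {f : Hom (fib A γ) y z} (p : y ≡ x) →
            fib A γ [ f ∘ eqToHom (op (fib A γ)) p ] ~ f
  opcastʳ {γ = γ} refl = from≡ (Category.identityʳ (fib A γ))

  cast~id : ∀ {x y : Ob (fib A γ)} (p : x ≡ y) → eqToHom (fib A γ) p ~ id (fib A γ) {x}
  cast~id refl = refl

  opcast~id : ∀ {x y : Ob (fib A γ)} (p : x ≡ y) →
              eqToHom (op (fib A γ)) p ~ id (fib A γ) {y}
  opcast~id refl = refl

  cast~ : ∀ {x y x′ y′ : Ob (fib A γ)} (p : x ≡ y) (q : x′ ≡ y′) → x ≡ x′ →
          eqToHom (fib A γ) p ~ eqToHom (fib A γ) q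
  cast~ refl refl refl = refl

  act-cast : ∀ {x y} (g : Hom Γ γ δ) (p : x ≡ y) →
             F₁ (act A g) (eqToHom (fib A γ) p) ~ id (fib A δ) {F₀ (act A g) x}
  act-cast g refl = from≡ (Functor.identity (act A g))

  -- Reassociation of three arrows whose composability is only up to the
  -- casts e, e′, k, k′.
  glue : ∀ {s₁ t₁ s₂ t₂ s₃ t₃ sF tF} {f₁ : Hom (fib A γ) s₁ t₁} {F : Hom (fib A γ) sF tF}
         {e′ : Hom (fib A γ) t₁ sF}
         {f₂ : Hom (fib A δ) s₂ t₂} {f₃ : Hom (fib A δ) s₃ t₃} {e : Hom (fib A δ) t₂ s₃}
         {ζ : Ob Γ} {s₁′ t₁′ s₂′ t₂′ s₃′ t₃′ sG tG}
         {G : Hom (fib A ε) sG tG} {f₃′ : Hom (fib A ε) s₃′ t₃′} {k : Hom (fib A ε) tG s₃′}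
         {f₁′ : Hom (fib A ζ) s₁′ t₁′} {f₂′ : Hom (fib A ζ) s₂′ t₂′}
         {k′ : Hom (fib A ζ) t₁′ s₂′} →
         F ~ fib A δ [ f₃ ∘ fib A δ [ e ∘ f₂ ] ] →
         G ~ fib A ζ [ f₂′ ∘ fib A ζ [ k′ ∘ f₁′ ] ] →
         f₁ ~ f₁′ → f₂ ~ f₂′ → f₃ ~ f₃′ →
         e′ ~ id (fib A γ) {t₁} → e ~ id (fib A δ) {t₂} →
         k ~ id (fib A ε) {tG} → k′ ~ id (fib A ζ) {t₁′} →
         fib A γ [ F ∘ fib A γ [ e′ ∘ f₁ ] ] ~ fib A ε [ f₃′ ∘ fib A ε [ k ∘ G ] ]
  glue {γ = γ} refl refl refl refl refl refl refl refl refl =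
    (refl ⟩∘⟨ idˡ) ◾ ((refl ⟩∘⟨ idˡ) ⟩∘⟨ refl) ◾ reassoc
    ◾ inv ((refl ⟩∘⟨ idˡ) ◾ (refl ⟩∘⟨ (refl ⟩∘⟨ idˡ)))
    where
    idˡ : ∀ {x y} {f : Hom (fib A γ) x y} → fib A γ [ id (fib A γ) ∘ f ] ~ f
    idˡ = from≡ (Category.identityˡ (fib A γ))

  act-castʳ : ∀ {x y z} (g : Hom Γ γ δ) (p : x ≡ y) {f : Hom (fib A δ) (F₀ (act A g) y) z} →
              fib A δ [ f ∘ F₁ (act A g) (eqToHom (fib A γ) p) ] ~ f
  act-castʳ {δ = δ} g refl =
    (refl ⟩∘⟨ from≡ (Functor.identity (act A g))) ◾ from≡ (Category.identityʳ (fib A δ))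

  act-castˡ : ∀ {x y z} (g : Hom Γ γ δ) (p : x ≡ y) {f : Hom (fib A δ) z (F₀ (act A g) x)} →
              fib A δ [ F₁ (act A g) (eqToHom (fib A γ) p) ∘ f ] ~ f
  act-castˡ {δ = δ} g refl =
    (from≡ (Functor.identity (act A g)) ⟩∘⟨ refl) ◾ from≡ (Category.identityˡ (fib A δ))

  act~ : ∀ {γ′ δ′ x y x′ y′} {g : Hom Γ γ δ} {g′ : Hom Γ γ′ δ′}
         {f : Hom (fib A γ) x y} {f′ : Hom (fib A γ′) x′ y′} →
         Γ [ g ≋ g′ ] → f ~ f′ → F₁ (act A g) f ~ F₁ (act A g′) f′
  act~ refl refl = refl

  act-id~ : ∀ {x y} {f : Hom (fib A γ) x y} → F₁ (act A (id Γ)) f ~ f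
  act-id~ = from≋ (Ty.act-id A _)

  act-∘~ : ∀ {x y} {g : Hom Γ δ ε} {k : Hom Γ γ δ} {f : Hom (fib A γ) x y} →
           F₁ (act A (Γ [ g ∘ k ])) f ~ F₁ (act A g) (F₁ (act A k) f)
  act-∘~ = from≋ (Ty.act-∘ A _ _ _)

  act-hom~ : ∀ {x y z} {g : Hom Γ γ δ} {f : Hom (fib A γ) y z} {k : Hom (fib A γ) x y} →
             F₁ (act A g) (fib A γ [ f ∘ k ])
               ~ fib A δ [ F₁ (act A g) f ∘ F₁ (act A g) k ]
  act-hom~ {g = g} = from≡ (Functor.homomorphism (act A g))

module _ {Γ : Category o h} (A : Ty Γ o′ h′) where

  act-id₀ : ∀ {γ} (x : Ob (fib A γ)) → F₀ (act A (id Γ)) x ≡ x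
  act-id₀ {γ} x = ≋-source (Ty.act-id A (id (fib A γ)))

  act-∘₀ : ∀ {γ δ ε} (g : Hom Γ δ ε) (f : Hom Γ γ δ) (x : Ob (fib A γ)) →
           F₀ (act A (Γ [ g ∘ f ])) x ≡ F₀ (act A g) (F₀ (act A f) x)
  act-∘₀ {γ} {ε = ε} g f x = ≋-source (Ty.act-∘ A g f (id (fib A γ)))

opTy : {Γ : Category o h} → Ty Γ o′ h′ → Ty Γ o′ h′
opTy A = record
  { fib    = λ γ → op (fib A γ)
  ; act    = λ g → opF (act A g)
  ; act-id = λ f → ≋-op (Ty.act-id A f)
  ; act-∘  = λ g k f → ≋-op (Ty.act-∘ A g k f)
  }

infixl 20 _[_]
_[_] : {Γ : Category o h} {Δ : Category o″ h″} →
       Ty Γ o′ h′ → Functor Δ Γ → Ty Δ o′ h′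
A [ σ ] = record
  { fib    = λ δ → fib A (F₀ σ δ)
  ; act    = λ g → act A (F₁ σ g)
  ; act-id = λ f → to≋ (act~ (≡⇒≋ (Functor.identity σ)) refl ◾ act-id~)
  ; act-∘  = λ g k f → to≋ (act~ (≡⇒≋ (Functor.homomorphism σ)) refl ◾ act-∘~)
  }
  where open Fibred A

pair≡ : {Γ : Category o h} (A : Ty Γ o′ h′) {γ δ : Ob Γ}
        {x : Ob (fib A γ)} {y : Ob (fib A δ)} {g g′ : Hom Γ γ δ}
        {ξ : Hom (fib A δ) (F₀ (act A g) x) y} {ξ′ : Hom (fib A δ) (F₀ (act A g′) x) y} →
        g ≡ g′ → Fibred._~_ A ξ ξ′ →
        _≡_ {A = Σ[ k ∈ Hom Γ γ δ ] Hom (fib A δ) (F₀ (act A k) x) y} (g , ξ) (g′ , ξ′)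
pair≡ A refl Fibred.refl = refl

-- The eqToHoms below stand for the equalities A(id) x = x and
-- A(g′ ∘ g) x = A(g′) (A(g) x), which are not definitional.
infixl 15 _⋄_
_⋄_ : (Γ : Category o h) → Ty Γ o′ h′ → Category (o ⊔ o′) (h ⊔ h′)
Γ ⋄ A = record
  { Ob  = Σ[ γ ∈ Ob Γ ] Ob (fib A γ)
  ; Hom = λ (γ , x) (δ , y) → Σ[ g ∈ Hom Γ γ δ ] Hom (fib A δ) (F₀ (act A g) x) y
  ; id  = λ { {γ , x} → id Γ , eqToHom (fib A γ) (act-id₀ A x) }
  ; _∘_ = λ { {γ , x} {δ , y} {ε , z} (g′ , ξ′) (g , ξ) →
              Γ [ g′ ∘ g ] ,
              fib A ε [ ξ′ ∘ fib A ε [ F₁ (act A g′) ξ ∘ eqToHom (fib A ε) (act-∘₀ A g′ g x) ] ] }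
  ; identityˡ = λ { {_ , x} {_ , y} {g , _} →
      pair≡ A (Category.identityˡ Γ)
        (castˡ (act-id₀ A y) ◾ castʳ (act-∘₀ A (id Γ) g x) ◾ act-id~) }
  ; identityʳ = λ { {_ , x} {_ , y} {g , _} →
      pair≡ A (Category.identityʳ Γ)
        ((refl ⟩∘⟨ castʳ (act-∘₀ A g (id Γ) x)) ◾ act-castʳ g (act-id₀ A x)) }
  ; assoc     = λ { {_ , w} {_ , x} {_ , y} {_ , z} {f , _} {g , _} {k , _} →
      pair≡ A (Category.assoc Γ)
        (((refl ⟩∘⟨ castʳ (act-∘₀ A f g x))
            ⟩∘⟨ (castʳ (act-∘₀ A (Γ [ f ∘ g ]) k w) ◾ act-∘~))
         ◾ reassoc
         ◾ (refl ⟩∘⟨ inv (castʳ (act-∘₀ A f (Γ [ g ∘ k ]) w) ◾ act-hom~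
                           ◾ (refl ⟩∘⟨ act~ refl (castʳ (act-∘₀ A g k w)))))) }
  }
  where open Fibred A

π : {Γ : Category o h} (A : Ty Γ o′ h′) → Functor (Γ ⋄ A) Γ
π A = record { F₀ = proj₁ ; F₁ = proj₁ ; identity = refl ; homomorphism = refl }

diag : {Γ : Category o h} (A : Ty Γ o′ h′) → Functor (Γ ⋄ A) (Γ ⋄ A ⋄ A [ π A ])
diag A = record
  { F₀           = λ (γ , a) → (γ , a) , a
  ; F₁           = λ (g , ξ) → (g , ξ) , ξ
  ; identity     = λ { {γ , a} →
      pair≡ (A [ π A ]) refl (cast~ (act-id₀ A a) (act-id₀ (A [ π A ]) {γ , a} a) refl) }
  ; homomorphism = λ { {_ , a} {f = f , φ} {g , ξ} →
      pair≡ (A [ π A ]) refl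
        (refl ⟩∘⟨ refl ⟩∘⟨ cast~ (act-∘₀ A f g a) (act-∘₀ (A [ π A ]) (f , φ) (g , ξ) a) refl) }
  }
  where open Fibred (A [ π A ])

discrete≋ : {X : Set ℓ} {x y x′ y′ : X} (p : x ≡ y) (q : x′ ≡ y′) → x ≡ x′ →
            Discrete X [ p ≋ q ]
discrete≋ refl refl refl = refl

-- Γ.b:A.a:Aᵒᵖ ⊢ Hom_A, sending (γ , b , a) to the discrete category on
-- hom(a , b).  An arrow (γ , b , a) → (γ′ , b′ , a′) consists of g : γ → γ′,
-- ξ : A(g) b → b′ and α : a′ → A(g) a.
HomTy : {Γ : Category o h} (A : Ty Γ o′ h′) → Ty (Γ ⋄ A ⋄ opTy (A [ π A ])) h′ h′
HomTy {Γ = Γ} A = record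
  { fib    = λ ((γ , b) , a) → Discrete (Hom (fib A γ) a b)
  ; act    = λ f → mapDiscrete (act₀ f)
  ; act-id = λ { {(γ , b) , a} p → discrete≋ _ _ (act₀-id _) }
  ; act-∘  = λ g f p → discrete≋ _ _ (act₀-∘ g f _)
  }
  where
  open Fibred A
  Γ₂ = Γ ⋄ A ⋄ opTy (A [ π A ])

  H : Ob Γ₂ → Set _
  H ((γ , b) , a) = Hom (fib A γ) a b

  act₀ : ∀ {x y} → Hom Γ₂ x y → H x → H y
  act₀ {y = (γ′ , _) , _} ((g , ξ) , α) k =
    fib A γ′ [ ξ ∘ fib A γ′ [ F₁ (act A g) k ∘ α ] ]

  act₀-id : ∀ {x} (k : H x) → act₀ (id Γ₂ {x}) k ≡ k
  act₀-id {γb@(_ , b) , a} k =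
    to≡ (castˡ (act-id₀ A b) ◾ opcastʳ (act-id₀ (opTy (A [ π A ])) {γb} a) ◾ act-id~)

  act₀-∘ : ∀ {x y z} (g : Hom Γ₂ y z) (f : Hom Γ₂ x y) (k : H x) →
           act₀ (Γ₂ [ g ∘ f ]) k ≡ act₀ g (act₀ f k)
  act₀-∘ {(_ , b) , a} {y} {z} ((g , ξ) , _) ((f , φ) , _) k = to≡
    (((refl ⟩∘⟨ castʳ (act-∘₀ A g f b))
        ⟩∘⟨ (act-∘~ ⟩∘⟨ (opcastˡ (act-∘₀ (opTy (A [ π A ])) {δ = proj₁ y} {proj₁ z} (g , ξ) (f , φ) a) ⟩∘⟨ refl)))
     ◾ reassoc
     ◾ (refl ⟩∘⟨ ((refl ⟩∘⟨ inv reassoc) ◾ inv reassoc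
                   ◾ (inv (act-hom~ ◾ (refl ⟩∘⟨ act-hom~)) ⟩∘⟨ refl))))

module _ {Δ : Category o h} (B : Ty Δ o′ h′) (C : Ty (Δ ⋄ opTy B) o″ h″) where

  private
    E = Δ ⋄ opTy B
    module B = Fibred B
    module C = Fibred C

  -- (g , id) : (δ , b) → (δ′ , B(g) b)
  lift : ∀ {δ δ′} (g : Hom Δ δ δ′) (b : Ob (fib B δ)) →
         Hom E (δ , b) (δ′ , F₀ (act B g) b)
  lift {δ′ = δ′} g b = g , id (fib B δ′)

  -- (id , β) : (δ , b′) → (δ , b) for β : b → b′ in B(δ).  The eqToHom
  -- mediates between b′ and B(id) b′.
  vert : ∀ {δ} {b b′ : Ob (fib B δ)} → Hom (fib B δ) b b′ →
         Hom E (δ , b′) (δ , b)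
  vert {δ} {b′ = b′} β = id Δ , fib B δ [ eqToHom (fib B δ) (sym (act-id₀ B b′)) ∘ β ]

  record TwistHom (x y : Σ (Ob (Δ ⋄ B)) λ δb → Ob (fib C δb)) :
                  Set (h ⊔ h′ ⊔ h″) where
    constructor twistHom
    private
      δ  = proj₁ (proj₁ x) ; b  = proj₂ (proj₁ x) ; c  = proj₂ x
      δ′ = proj₁ (proj₁ y) ; b′ = proj₂ (proj₁ y) ; c′ = proj₂ y
    field
      g : Hom Δ δ δ′
      β : Hom (fib B δ′) (F₀ (act B g) b) b′
      θ : Hom (fib C (δ′ , F₀ (act B g) b))
            (F₀ (act C (lift g b)) c) (F₀ (act C (vert β)) c′)

  private
    pairE≡ : ∀ {δ δ′ b b′} {g g′ : Hom Δ δ δ′} {ξ : Hom (fib B δ′) b′ (F₀ (act B g) b)}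
             {ξ′ : Hom (fib B δ′) b′ (F₀ (act B g′) b)} → g ≡ g′ → ξ B.~ ξ′ →
             _≡_ {A = Hom E (δ , b) (δ′ , b′)} (g , ξ) (g′ , ξ′)
    pairE≡ refl B.refl = refl

    lift≋ : ∀ {δ δ′} {g : Hom Δ δ δ′} {b b′} → b ≡ b′ → E [ lift g b ≋ lift g b′ ]
    lift≋ refl = refl

    vert≋ : ∀ {δ} {b₁ b₁′ b₂ b₂′ : Ob (fib B δ)} {β₁ : Hom (fib B δ) b₁ b₁′}
            {β₂ : Hom (fib B δ) b₂ b₂′} → β₁ B.~ β₂ → E [ vert β₁ ≋ vert β₂ ]
    vert≋ B.refl = refl

    vert-id : ∀ {δ} {b : Ob (fib B δ)} → vert (id (fib B δ) {b}) ≡ id E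
    vert-id {δ} {b} = pairE≡ refl
      (B.castˡ (sym (act-id₀ B b)) B.◾ B.inv (B.opcast~id (act-id₀ (opTy B) b)))

    vert-cast : ∀ {δ} {b b′ : Ob (fib B δ)} (p : b ≡ b′) →
                E [ vert (eqToHom (fib B δ) p) ≋ id E {δ , b′} ]
    vert-cast refl = ≡⇒≋ vert-id

    vert-∘ : ∀ {δ} {b b′ b″ : Ob (fib B δ)} (β′ : Hom (fib B δ) b′ b″)
             (β : Hom (fib B δ) b b′) →
             vert (fib B δ [ β′ ∘ β ]) ≡ E [ vert β ∘ vert β′ ]
    vert-∘ {b = b} {b′} {b″} β′ β = pairE≡ (sym (Category.identityˡ Δ))
      (B.castˡ (sym (act-id₀ B b″)) B.◾
       B.inv ((B.opcastˡ (act-∘₀ (opTy B) (id Δ) (id Δ) b″) B.◾ B.act-id~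
                 B.◾ B.castˡ (sym (act-id₀ B b″)))
               B.⟩∘⟨ B.castˡ (sym (act-id₀ B b′))))

    lift-id : ∀ {δ} (b : Ob (fib B δ)) →
              lift (id Δ) b ≡ vert (eqToHom (fib B δ) (act-id₀ B b))
    lift-id b = pairE≡ refl (B.inv
      (B.castˡ (sym (act-id₀ B b)) B.◾ B.cast~id (act-id₀ B b)))

    lift-∘ : ∀ {δ δ′ δ″} (g′ : Hom Δ δ′ δ″) (g : Hom Δ δ δ′) (b : Ob (fib B δ)) →
             lift (Δ [ g′ ∘ g ]) b ≡
             E [ vert (eqToHom (fib B δ″) (act-∘₀ B g′ g b))
               ∘ E [ lift g′ (F₀ (act B g) b) ∘ lift g b ] ]
    lift-∘ {δ″ = δ″} g′ g b = pairE≡ (sym (Category.identityˡ Δ)) (B.inv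
      (((B.opcastˡ (act-∘₀ (opTy B) (id Δ) (Δ [ g′ ∘ g ]) b)
           B.◾ B.act-id~
           B.◾ (B.opcastˡ (act-∘₀ (opTy B) g′ g b) B.⟩∘⟨ B.refl)
           B.◾ B.from≡ (Category.identityʳ (fib B δ″))
           B.◾ B.from≡ (Functor.identity (act B g′)))
         B.⟩∘⟨ (B.castˡ (sym (act-id₀ B (F₀ (act B g′) (F₀ (act B g) b))))))
       B.◾ B.from≡ (Category.identityˡ (fib B δ″))
       B.◾ B.cast~id (act-∘₀ B g′ g b)))

    lift-vert : ∀ {δ δ′} (g : Hom Δ δ δ′) {b b′ : Ob (fib B δ)} (β : Hom (fib B δ) b b′) →
                E [ lift g b ∘ vert β ] ≡ E [ vert (F₁ (act B g) β) ∘ lift g b′ ]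
    lift-vert {δ′ = δ′} g {b} {b′} β =
      pairE≡ (trans (Category.identityʳ Δ) (sym (Category.identityˡ Δ)))
        (B.from≡ (Category.identityʳ (fib B δ′))
         B.◾ B.opcastˡ (act-∘₀ (opTy B) g (id Δ) b′)
         B.◾ B.act~ refl (B.castˡ (sym (act-id₀ B b′)))
         B.◾ B.inv ((B.opcastˡ (act-∘₀ (opTy B) (id Δ) g b′)
                       B.◾ B.act-id~)
                      B.⟩∘⟨ B.castˡ (sym (act-id₀ B (F₀ (act B g) b′)))
                     B.◾ B.from≡ (Category.identityˡ (fib B δ′))))

    id∘≋ : ∀ {x y z} {m : Hom E y z} {n : Hom E x y} →
           E [ m ≋ id E {y} ] → E [ E [ m ∘ n ] ≋ n ]
    id∘≋ refl = ≡⇒≋ (Category.identityˡ E)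

    lift-∘≋ : ∀ {δ δ′ δ″} (g′ : Hom Δ δ′ δ″) (g : Hom Δ δ δ′) (b : Ob (fib B δ)) →
              E [ lift (Δ [ g′ ∘ g ]) b ≋ E [ lift g′ (F₀ (act B g) b) ∘ lift g b ] ]
    lift-∘≋ g′ g b = ≋-trans (≡⇒≋ (lift-∘ g′ g b)) (id∘≋ (vert-cast (act-∘₀ B g′ g b)))

    act₀≡ : ∀ {x y} {m n : Hom E x y} (c : Ob (fib C x)) → m ≡ n →
            F₀ (act C m) c ≡ F₀ (act C n) c
    act₀≡ c refl = refl

    θ-id : ∀ {δ} (b : Ob (fib B δ)) (c : Ob (fib C (δ , b))) →
           F₀ (act C (lift (id Δ) b)) c
             ≡ F₀ (act C (vert (eqToHom (fib B δ) (act-id₀ B b)))) c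
    θ-id b c = act₀≡ c (lift-id b)

    act-vert : ∀ {δ} {b b′ : Ob (fib B δ)} (p : b ≡ b′) {x y} {f : Hom (fib C (δ , b′)) x y} →
               F₁ (act C (vert (eqToHom (fib B δ) p))) f C.~ f
    act-vert p = C.act~ (vert-cast p) C.refl C.◾ C.act-id~

    -- θ″ is  C(id,B(g′)β)θ′ ∘ C(g′,id)θ,  up to the strict equalities between
    -- the objects involved.
    module Comp {δ δ′ δ″ : Ob Δ} (g′ : Hom Δ δ′ δ″) (g : Hom Δ δ δ′)
                {b : Ob (fib B δ)} {b′ : Ob (fib B δ′)} {b″ : Ob (fib B δ″)}
                (β′ : Hom (fib B δ″) (F₀ (act B g′) b′) b″)
                (β : Hom (fib B δ′) (F₀ (act B g) b) b′)
                (c : Ob (fib C (δ , b))) (c′ : Ob (fib C (δ′ , b′)))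
                (c″ : Ob (fib C (δ″ , b″))) where

      e : Hom (fib B δ″) (F₀ (act B (Δ [ g′ ∘ g ])) b) (F₀ (act B g′) (F₀ (act B g) b))
      e = eqToHom (fib B δ″) (act-∘₀ B g′ g b)

      g″ = Δ [ g′ ∘ g ]
      β″ = fib B δ″ [ β′ ∘ fib B δ″ [ F₁ (act B g′) β ∘ e ] ]

      source : F₀ (act C (lift g″ b)) c
                 ≡ F₀ (act C (vert e))
                     (F₀ (act C (lift g′ (F₀ (act B g) b))) (F₀ (act C (lift g b)) c))
      source = trans (act₀≡ c (lift-∘ g′ g b))
        (trans (act-∘₀ C _ _ c) (cong (F₀ (act C (vert e))) (act-∘₀ C _ _ c)))

      middle : F₀ (act C (lift g′ (F₀ (act B g) b))) (F₀ (act C (vert β)) c′)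
                 ≡ F₀ (act C (vert (F₁ (act B g′) β))) (F₀ (act C (lift g′ b′)) c′)
      middle = trans (sym (act-∘₀ C _ _ c′))
        (trans (act₀≡ c′ (lift-vert g′ β)) (act-∘₀ C _ _ c′))

      target : F₀ (act C (vert e))
                 (F₀ (act C (vert (F₁ (act B g′) β))) (F₀ (act C (vert β′)) c″))
                 ≡ F₀ (act C (vert β″)) c″
      target = sym (trans (act₀≡ c″ (vert-∘ _ _)) (trans (act-∘₀ C _ _ c″)
        (trans (act₀≡ (F₀ (act C (vert β′)) c″) (vert-∘ _ _)) (act-∘₀ C _ _ _))))

      module _ (θ′ : Hom (fib C (δ″ , F₀ (act B g′) b′))
                       (F₀ (act C (lift g′ b′)) c′) (F₀ (act C (vert β′)) c″))
               (θ : Hom (fib C (δ′ , F₀ (act B g) b))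
                      (F₀ (act C (lift g b)) c) (F₀ (act C (vert β)) c′)) where

        private
          X = fib C (δ″ , F₀ (act B g′) (F₀ (act B g) b))
          Y = fib C (δ″ , F₀ (act B g″) b)
          Vβ = vert (F₁ (act B g′) β)
          Lg = lift g′ (F₀ (act B g) b)

        ψ : Hom X (F₀ (act C Lg) (F₀ (act C (lift g b)) c))
                  (F₀ (act C Vβ) (F₀ (act C (vert β′)) c″))
        ψ = X [ F₁ (act C Vβ) θ′ ∘ X [ eqToHom X middle ∘ F₁ (act C Lg) θ ] ]

        θ″ : Hom Y (F₀ (act C (lift g″ b)) c) (F₀ (act C (vert β″)) c″)
        θ″ = Y [ eqToHom Y target ∘ Y [ F₁ (act C (vert e)) ψ ∘ eqToHom Y source ] ]

        θ″~ : θ″ C.~ X [ F₁ (act C Vβ) θ′ ∘ X [ eqToHom X middle ∘ F₁ (act C Lg) θ ] ]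
        θ″~ = C.castˡ target C.◾ C.castʳ source
              C.◾ act-vert (act-∘₀ B g′ g b)

    act-vert-cast : ∀ {δ δ′} (g : Hom Δ δ δ′) {b b′ : Ob (fib B δ)} (p : b ≡ b′)
                    {x y} {f : Hom (fib C (δ′ , F₀ (act B g) b′)) x y} →
                    F₁ (act C (vert (F₁ (act B g) (eqToHom (fib B δ) p)))) f C.~ f
    act-vert-cast g refl = C.act~ (≋-trans (vert≋ (B.from≡ (Functor.identity (act B g))))
                                    (≡⇒≋ vert-id)) C.refl C.◾ C.act-id~

  twistHom≡ : ∀ {x y} {f f′ : TwistHom x y} (let open TwistHom) →
              _≡_ {A = Hom (Δ ⋄ B) (proj₁ x) (proj₁ y)} (g f , β f) (g f′ , β f′) →
              θ f C.~ θ f′ → f ≡ f′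
  twistHom≡ refl C.refl = refl

  -- Written Δ ⋄ (B ⋉ C).
  Total⋉ : Category (o ⊔ o′ ⊔ o″) (h ⊔ h′ ⊔ h″)
  Total⋉ = record
    { Ob  = Σ (Ob (Δ ⋄ B)) λ δb → Ob (fib C δb)
    ; Hom = TwistHom
    ; id  = λ { {(δ , b) , c} → record
        { g = id Δ
        ; β = eqToHom (fib B δ) (act-id₀ B b)
        ; θ = eqToHom (fib C (δ , F₀ (act B (id Δ)) b)) (θ-id b c) } }
    ; _∘_ = λ { {_ , c} {_ , c′} {_ , c″} (twistHom g′ β′ θ′) (twistHom g β θ) →
        let module K = Comp g′ g β′ β c c′ c″ in
        record { g = K.g″ ; β = K.β″ ; θ = K.θ″ θ′ θ } }
    ; identityˡ = λ { {(_ , b) , c} {(_ , b′) , c′} {twistHom g β θ} →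
        twistHom≡ (Category.identityˡ (Δ ⋄ B))
          (Comp.θ″~ (id Δ) g _ β c c′ c′ _ θ
           C.◾ C.act-castˡ (vert (F₁ (act B (id Δ)) β)) (θ-id b′ c′)
           C.◾ C.castˡ (Comp.middle (id Δ) g (eqToHom (fib B _) (act-id₀ B b′)) β c c′ c′)
           C.◾ C.act~ (≡⇒≋ (lift-id (F₀ (act B g) b))) C.refl
           C.◾ C.act~ (vert-cast (act-id₀ B (F₀ (act B g) b))) C.refl
           C.◾ C.act-id~) }
    ; identityʳ = λ { {(_ , b) , c} {(_ , b′) , c′} {twistHom g β θ} →
        twistHom≡ (Category.identityʳ (Δ ⋄ B))
          (Comp.θ″~ g (id Δ) β _ c c c′ θ _
           C.◾ (C.refl C.⟩∘⟨ C.act-castʳ (lift g (F₀ (act B (id Δ)) b)) (θ-id b c))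
           C.◾ C.castʳ (Comp.middle g (id Δ) β (eqToHom (fib B _) (act-id₀ B b)) c c c′)
           C.◾ act-vert-cast g (act-id₀ B b)) }
    ; assoc = λ { {(_ , b₁) , c₁} {(_ , b₂) , c₂} {(_ , b₃) , c₃} {(δ₄ , b₄) , c₄}
                  {twistHom g₃ β₃ θ₃} {twistHom g₂ β₂ θ₂} {twistHom g₁ β₁ θ₁} →
        let module K₃₂ = Comp g₃ g₂ β₃ β₂ c₂ c₃ c₄
            module K₂₁ = Comp g₂ g₁ β₂ β₁ c₁ c₂ c₃
            module L = Comp K₃₂.g″ g₁ K₃₂.β″ β₁ c₁ c₂ c₄
            module R = Comp g₃ K₂₁.g″ β₃ K₂₁.β″ c₁ c₃ c₄
            V≋ = vert≋ (B.act-∘~ {f = β₁})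
            L′ = lift g₃ (F₀ (act B g₂) (F₀ (act B g₁) b₁))
            vert₃≋ = ≋-trans
              (vert≋ (B.act~ refl (B.refl B.⟩∘⟨ B.castʳ (act-∘₀ B g₂ g₁ b₁)) B.◾ B.act-hom~))
              (≡⇒≋ (vert-∘ (F₁ (act B g₃) β₂) (F₁ (act B g₃) (F₁ (act B g₂) β₁))))
            V′ = vert (F₁ (act B g₃) (F₁ (act B g₂) β₁))
        in
        twistHom≡ (Category.assoc (Δ ⋄ B))
          (L.θ″~ (K₃₂.θ″ θ₃ θ₂) θ₁
           C.◾ C.glue
                 (C.act~ V≋ (K₃₂.θ″~ θ₃ θ₂) C.◾ C.act-hom~ C.◾ (C.refl C.⟩∘⟨ C.act-hom~))
                 (C.act~ (lift≋ (act-∘₀ B g₂ g₁ b₁)) (K₂₁.θ″~ θ₂ θ₁)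
                   C.◾ C.act-hom~ C.◾ (C.refl C.⟩∘⟨ C.act-hom~))
                 (C.act~ (lift-∘≋ g₃ g₂ (F₀ (act B g₁) b₁)) C.refl C.◾ C.act-∘~)
                 (C.inv C.act-∘~
                   C.◾ C.act~ (≡⇒≋ (sym (lift-vert g₃ (F₁ (act B g₂) β₁)))) C.refl
                   C.◾ C.act-∘~)
                 (C.inv C.act-∘~ C.◾ C.act~ (≋-sym vert₃≋) C.refl)
                 (C.cast~id L.middle)
                 (C.act-cast V′ K₃₂.middle)
                 (C.cast~id R.middle)
                 (C.act-cast L′ K₂₁.middle)
           C.◾ C.inv (R.θ″~ θ₃ (K₂₁.θ″ θ₂ θ₁))) }
    }

record Tyᵈ (Γ : Category o h) (o′ h′ : Level) : Set (o ⊔ h ⊔ suc (o′ ⊔ h′)) where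
  field
    total : Category o′ h′
    proj  : Functor total Γ

open Tyᵈ using (total; proj)

record Tmᵈ {Γ : Category o h} (E : Tyᵈ Γ o′ h′) : Set (o ⊔ h ⊔ o′ ⊔ h′) where
  field
    sect    : Functor Γ (total E)
    is-sect : proj E ∘F sect ≈ idF

open Tmᵈ using (sect)

-- Δ.b:B ⊢ C[b̄/b]
twist : {Δ : Category o h} (B : Ty Δ o′ h′) (C : Ty (Δ ⋄ opTy B) o″ h″) →
        Tyᵈ (Δ ⋄ B) (o ⊔ o′ ⊔ o″) (h ⊔ h′ ⊔ h″)
twist B C = record
  { total = Total⋉ B C
  ; proj  = record
    { F₀           = proj₁
    ; F₁           = λ f → TwistHom.g f , TwistHom.β f
    ; identity     = refl
    ; homomorphism = refl
    }
  }

∘-cong≋ : {C : Category o h} {x y z x′ y′ z′ : Ob C}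
          {f : Hom C y z} {f′ : Hom C y′ z′} {g : Hom C x y} {g′ : Hom C x′ y′} →
          C [ f ≋ f′ ] → C [ g ≋ g′ ] → C [ C [ f ∘ g ] ≋ C [ f′ ∘ g′ ] ]
∘-cong≋ refl refl = refl

id≋ : {C : Category o h} {x y : Ob C} → x ≡ y → C [ id C {x} ≋ id C {y} ]
id≋ refl = refl

triple≡ : {X : Set o} {Y : Set o′} {P : X → Y → Set h} →
          (∀ {x y} (p q : P x y) → p ≡ q) →
          {x x′ : X} {y y′ : Y} {p : P x y} {p′ : P x′ y′} → x ≡ x′ → y ≡ y′ →
          _≡_ {A = Σ[ x ∈ X ] Σ[ y ∈ Y ] P x y} (x , y , p) (x′ , y′ , p′)
triple≡ irr refl refl = cong (λ p → _ , _ , p) (irr _ _)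

≋-irrelevant : {C : Category o h} {x y x′ y′ : Ob C} {f : Hom C x y} {g : Hom C x′ y′}
               (p q : C [ f ≋ g ]) → p ≡ q
≋-irrelevant refl refl = refl

-- Strict pullback.
infixl 20 _[_]ᵈ
_[_]ᵈ : {Γ : Category o h} {Δ : Category o″ h″} →
        Tyᵈ Γ o′ h′ → Functor Δ Γ → Tyᵈ Δ (o ⊔ o′ ⊔ o″) (o ⊔ h ⊔ h′ ⊔ h″)
_[_]ᵈ {Γ = Γ} {Δ = Δ} E σ = record
  { total = record
    { Ob        = Σ[ δ ∈ Ob Δ ] Σ[ e ∈ Ob (total E) ] F₀ σ δ ≡ F₀ (proj E) e
    ; Hom       = λ (δ , e , _) (δ′ , e′ , _) →
                    Σ[ f ∈ Hom Δ δ δ′ ] Σ[ k ∈ Hom (total E) e e′ ]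
                      Γ [ F₁ σ f ≋ F₁ (proj E) k ]
    ; id        = λ { {_ , _ , p} → id Δ , id (total E) ,
                        ≋-trans (≡⇒≋ (Functor.identity σ))
                          (≋-trans (id≋ p) (≡⇒≋ (sym (Functor.identity (proj E))))) }
    ; _∘_       = λ (f′ , k′ , p′) (f , k , p) → Δ [ f′ ∘ f ] , total E [ k′ ∘ k ] ,
                    ≋-trans (≡⇒≋ (Functor.homomorphism σ))
                      (≋-trans (∘-cong≋ p′ p) (≡⇒≋ (sym (Functor.homomorphism (proj E)))))
    ; identityˡ = triple≡ ≋-irrelevant (Category.identityˡ Δ) (Category.identityˡ (total E))
    ; identityʳ = triple≡ ≋-irrelevant (Category.identityʳ Δ) (Category.identityʳ (total E))
    ; assoc     = triple≡ ≋-irrelevant (Category.assoc Δ) (Category.assoc (total E))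
    }
  ; proj  = record { F₀ = proj₁ ; F₁ = proj₁ ; identity = refl ; homomorphism = refl }
  }

-- Γ.a:A ⊢ Hom_A(ā , a)
HomTyᵈ : {Γ : Category o h} (A : Ty Γ o′ h′) →
         Tyᵈ (Γ ⋄ A) (o ⊔ o′ ⊔ h′) (o ⊔ o′ ⊔ h ⊔ h′)
HomTyᵈ A = twist (A [ π A ]) (HomTy A) [ diag A ]ᵈ

{-# OPTIONS --safe #-}

-- On an arrow (g , ξ) : (γ , a) → (γ′ , a′) the section refl takes the value
-- (g , ξ , θ), where θ is an arrow of the discrete category on
-- hom(A(g) a , a′), that is, an equality  ξ ∘ A(g) id ≡ id ∘ ξ.  As θ carries
-- no data, functoriality reduces to that of the diagonal.

module Submission where

open import Defs
open import Data.Product using (Σ-syntax; _,_)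
open import Relation.Binary.PropositionalEquality using (_≡_; refl; sym)

module _ {o h o′ h′} {Γ : Category o h} (A : Ty Γ o′ h′) where

  open Ty A
  open Category using (Ob; Hom; identityˡ; identityʳ)
  open Fibred A

  private
    Aπ = A [ π A ]
    module H = Fibred (HomTy A)

  -- Both sides collapse to `ξ`: `act` preserves identities and casts are absorbed. The intermediate
  -- arrows have different endpoints, hence the chain in `_~_`.
  lift-id≡vert-id :
    ∀ {γ δ} {a : Ob (fib γ)} {b : Ob (fib δ)}
    (g : Hom Γ γ δ) (ξ : Hom (fib δ) (Functor.F₀ (act g) a) b) →
    Functor.F₀ (Ty.act (HomTy A) (lift Aπ (HomTy A) {γ , a} {δ , b} (g , ξ) a)) (id (fib γ))
      ≡ Functor.F₀ (Ty.act (HomTy A) (vert Aπ (HomTy A) {δ , b} ξ)) (id (fib δ))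
  lift-id≡vert-id {γ} {δ} {a} {b} g ξ = to≡
    ((refl ⟩∘⟨ (from≡ (identityʳ (fib δ)) ◾ from≡ (Functor.identity (act g))))
     ◾ from≡ (identityʳ (fib δ))
     -- The outer cast comes from the identity of `Γ ⋄ A`, the inner one from `vert`.
     ◾ inv (castˡ (act-id₀ A b)
            ◾ (from≡ (Functor.identity (act (id Γ))) ⟩∘⟨ refl)
            ◾ from≡ (identityˡ (fib δ))
            ◾ castˡ (sym (act-id₀ Aπ {δ , b} b))))

  reflTm : Tmᵈ (HomTyᵈ A)
  reflTm = record
    { sect = record
      { F₀ = λ { (γ , a) → (γ , a) , (((γ , a) , a) , id (fib γ)) , refl }
      ; F₁ = λ { (g , ξ) →
          (g , ξ) , twistHom (g , ξ) ξ (lift-id≡vert-id g ξ) , refl }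
      ; identity = triple≡ ≋-irrelevant refl
          (twistHom≡ Aπ (HomTy A) (Functor.identity (diag A))
            -- In a discrete category equal sources suffice; here they agree definitionally.
            (H.from≋ (discrete≋ _ _ refl)))
      ; homomorphism = λ { {f = f} {g} → triple≡ ≋-irrelevant refl
          (twistHom≡ Aπ (HomTy A) (Functor.homomorphism (diag A) {f = f} {g})
            (H.from≋ (discrete≋ _ _ refl))) }
      }
    ; is-sect = λ _ → refl
    }

proposition31 : ∀ {o h o′ h′} (Γ : Category o h) (A : Ty Γ o′ h′) →
    Σ[ reflₐ ∈ Tmᵈ (HomTyᵈ A) ]
    ((γ : Category.Ob Γ) (a : Category.Ob (Ty.fib A γ)) →
    Functor.F₀ (Tmᵈ.sect reflₐ) (γ , a)
    ≡ ((γ , a) , (((γ , a) , a) , id (Ty.fib A γ) {a}) , refl))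
proposition31 Γ A = reflTm A , λ _ _ → refl
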